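{- (Reduction Lemma) Let $G_0$ be an acyclic graph on the vertex set $[n+1]$ with $d$ edges, and let $(i,j),(j,k)\in E(G_0)$ for some $i<j<k$. Let $G_1,G_2,G_3$ be the graphs on $[n+1]$ with edge sets $$E(G_1)=E(G_0)\setminus\{(j,k)\}\cup\{(i,k)\},$$ $$E(G_2)=E(G_0)\setminus\{(i,j)\}\cup\{(i,k)\},$$ $$E(G_3)=E(G_0)\setminus\{(i,j)\}\setminus\{(j,k)\}\cup\{(i,k)\}.$$ Then $G_1,G_2,G_3$ are acyclic, $$\mathcal{P}(G_0)=\mathcal{P}(G_1)\cup\mathcal{P}(G_2),$$ where all polytopes $\mathcal{P}(G_0),\mathcal{P}(G_1),\mathcal{P}(G_2)$ are $d$-dimensional, and $$\mathcal{P}(G_3)=\mathcal{P}(G_1)\cap\mathcal{P}(G_2)$$ is $(d-1)$-dimensional.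
   Context: $[n+1]=\{1,\ldots,n+1\}$; an edge joining $i<j$ is written $(i,j)$. Let $e_1,\ldots,e_{n+1}$ be the coordinate vectors of $\mathbb{R}^{n+1}$. $\mathcal{P}(A_n^+)$ is the convex hull of the origin and the points $e_i-e_j$, $1\le i<j\le n+1$. For a graph $G$ on $[n+1]$, $\mathcal{C}(G)$ is the cone of nonnegative linear combinations of the vectors $e_i-e_j$ with $(i,j)\in E(G)$, $i<j$, and $\mathcal{P}(G)=\mathcal{P}(A_n^+)\cap\mathcal{C}(G)$ (equivalently, the convex hull of the origin and all $e_i-e_j$, $i<j$, lying in $\mathcal{C}(G)$). -}

module Defs where

open import Algebra.Core using (Op₁; Op₂)
open import Algebra.Bundles using (CommutativeRing)
open import Algebra.Structures using (IsCommutativeRing)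
open import Algebra.Definitions using (Invertible)
import Algebra.Properties.Monoid.Sum as MonoidSum
open import Data.Bool.Base using (if_then_else_)
open import Data.Fin.Base using (Fin; _<_)
open import Data.Fin.Properties using (_≟_)
open import Data.List.Base using (List; _∷_; _∷ʳ_; length; filter; allFin; cartesianProduct)
open import Data.List.Relation.Unary.Linked using (Linked)
open import Data.List.Relation.Unary.Unique.Propositional using (Unique)
open import Data.Nat.Base as ℕ using (ℕ; suc)
open import Data.Product.Base using (_×_; _,_; ∃-syntax)
open import Data.Sum.Base using (_⊎_)
open import Data.Vec.Functional using (Vector)
import Data.Vec.Functional.Relation.Binary.Equality.Setoid as VecEq
open import Level using (Level; _⊔_; 0ℓ) renaming (suc to lsuc)
open import Relation.Binary.Core using (Rel)
open import Relation.Binary.Structures using (IsTotalOrder)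
open import Relation.Nullary using (¬_)
open import Relation.Nullary.Decidable using (does)
open import Relation.Unary using (Pred; Decidable; _∈_; _≐_; _∩_)

------------------------------------------------------------------------
-- Graphs

-- A simple graph on m vertices.  The vertex a of {1,…,m} is the element of
-- Fin m with toℕ equal to a − 1, and the edge joining i < j is the pair (i , j).

record Graph (m : ℕ) : Set₁ where
  field
    E       : Pred (Fin m × Fin m) 0ℓ
    E?      : Decidable E
    ordered : ∀ {i j} → (i , j) ∈ E → i < j

open Graph public

Adjacent : ∀ {m} → Graph m → Rel (Fin m) 0ℓ
Adjacent G u v = (u , v) ∈ E G ⊎ (v , u) ∈ E G

edgeCount : ∀ {m} → Graph m → ℕ
edgeCount {m} G = length (filter (E? G) (cartesianProduct (allFin m) (allFin m)))

record Cycle {m : ℕ} (G : Graph m) : Set where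
  field
    start    : Fin m
    rest     : List (Fin m)
    long     : 2 ℕ.≤ length rest
    distinct : Unique (start ∷ rest)
    closed   : Linked (Adjacent G) (start ∷ rest ∷ʳ start)

Acyclic : ∀ {m} → Graph m → Set
Acyclic G = ¬ Cycle G

------------------------------------------------------------------------
-- Ordered fields

-- The real numbers enter only as a (totally) ordered field, so the scalars
-- are an arbitrary one; ℝ, with its classical total order, is the intended case.

record OrderedField (c ℓ₁ ℓ₂ : Level) : Set (lsuc (c ⊔ ℓ₁ ⊔ ℓ₂)) where
  infix  8 -_
  infixl 7 _*_
  infixl 6 _+_
  infix  4 _≈_ _≤_
  field
    Carrier           : Set c
    _≈_               : Rel Carrier ℓ₁
    _≤_               : Rel Carrier ℓ₂
    _+_               : Op₂ Carrier
    _*_               : Op₂ Carrier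
    -_                : Op₁ Carrier
    0#                : Carrier
    1#                : Carrier
    isCommutativeRing : IsCommutativeRing _≈_ _+_ _*_ -_ 0# 1#
    isTotalOrder      : IsTotalOrder _≈_ _≤_
    0≉1               : ¬ (0# ≈ 1#)
    invertible        : ∀ x → ¬ (x ≈ 0#) → Invertible _≈_ 1# _*_ x
    +-monoʳ-≤         : ∀ z {x y} → x ≤ y → (z + x) ≤ (z + y)
    *-nonNegative     : ∀ {x y} → 0# ≤ x → 0# ≤ y → 0# ≤ (x * y)

  commutativeRing : CommutativeRing c ℓ₁
  commutativeRing = record { isCommutativeRing = isCommutativeRing }

------------------------------------------------------------------------
-- Convex geometry in coordinate space, and root polytopes

module RootPolytope {c ℓ₁ ℓ₂ : Level} (F : OrderedField c ℓ₁ ℓ₂) where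

  open OrderedField F
  open CommutativeRing commutativeRing public
    using (_-_; setoid; +-monoid)
  open MonoidSum +-monoid public using (sum)
  open VecEq setoid public using (_≋_)

  Point : ℕ → Set c
  Point m = Vector Carrier m

  origin : ∀ {m} → Point m
  origin _ = 0#

  e : ∀ {m} → Fin m → Point m
  e i a = if does (i ≟ a) then 1# else 0#

  root : ∀ {m} → Fin m → Fin m → Point m
  root i j a = e i a - e j a

  combination : ∀ {m k} → Vector Carrier k → Vector (Point m) k → Point m
  combination w p a = sum (λ t → w t * p t a)

  module _ {m : ℕ} {ℓ : Level} (S : Pred (Point m) ℓ) where

    Conv : Pred (Point m) (c ⊔ ℓ₁ ⊔ ℓ₂ ⊔ ℓ)
    Conv x = ∃[ k ] ∃[ w ] ∃[ p ]
      ((t : Fin k) → p t ∈ S) × (∀ t → 0# ≤ w t) × (sum w ≈ 1#) × (x ≋ combination w p)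

    Cone : Pred (Point m) (c ⊔ ℓ₁ ⊔ ℓ₂ ⊔ ℓ)
    Cone x = ∃[ k ] ∃[ w ] ∃[ p ]
      ((t : Fin k) → p t ∈ S) × (∀ t → 0# ≤ w t) × (x ≋ combination w p)

    Aff : Pred (Point m) (c ⊔ ℓ₁ ⊔ ℓ)
    Aff x = ∃[ k ] ∃[ w ] ∃[ p ]
      ((t : Fin k) → p t ∈ S) × (sum w ≈ 1#) × (x ≋ combination w p)

  AffinelyIndependent : ∀ {m k} → Vector (Point m) k → Set (c ⊔ ℓ₁)
  AffinelyIndependent {k = k} p =
    (w : Vector Carrier k) → sum w ≈ 0# → combination w p ≋ origin → ∀ t → w t ≈ 0#

  Range : ∀ {m k} → Vector (Point m) k → Pred (Point m) ℓ₁
  Range p x = ∃[ t ] (x ≋ p t)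

  -- The dimension of a set is that of its affine hull, which is d when the
  -- hull has an affine basis of d + 1 points.
  HasDimension : ∀ {m ℓ} → Pred (Point m) ℓ → ℕ → Set (c ⊔ ℓ₁ ⊔ ℓ)
  HasDimension {m} S d =
    ∃[ b ] AffinelyIndependent {m} {suc d} b × (Aff (Range b) ≐ Aff S)

  OriginOrPositiveRoot : ∀ {m} → Pred (Point m) ℓ₁
  OriginOrPositiveRoot x =
    (x ≋ origin) ⊎ (∃[ i ] ∃[ j ] (i < j) × (x ≋ root i j))

  -- With m = n + 1 this is 𝒫(Aₙ⁺).
  𝒫A⁺ : ∀ {m} → Pred (Point m) (c ⊔ ℓ₁ ⊔ ℓ₂)
  𝒫A⁺ = Conv OriginOrPositiveRoot

  EdgeVector : ∀ {m} → Graph m → Pred (Point m) ℓ₁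
  EdgeVector G x = ∃[ i ] ∃[ j ] ((i , j) ∈ E G) × (x ≋ root i j)

  𝒞 : ∀ {m} → Graph m → Pred (Point m) (c ⊔ ℓ₁ ⊔ ℓ₂)
  𝒞 G = Cone (EdgeVector G)

  𝒫 : ∀ {m} → Graph m → Pred (Point m) (c ⊔ ℓ₁ ⊔ ℓ₂)
  𝒫 G = 𝒫A⁺ ∩ 𝒞 G

{-# OPTIONS --safe #-}
module Submission where

-- In an acyclic graph every edge (a , b) is a bridge, so it has a potential, a linear
-- functional equal to 1 on eₐ − e_b and to 0 on all other edge vectors.  Conversely a graph
-- whose edges have such dual potentials is acyclic, since going round the rest of a cycle
-- would not change the potential.  Dual potentials also make the edge vectors linearly
-- independent, so together with the origin they form an affine basis of the polytope.
-- They survive the exchange of (j , k) for (i , k): take over the potential of (j , k),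
-- and replace the one of (i , j) by its difference with that of (j , k).
--
-- A point of the cone of G₀ is α (eᵢ − eⱼ) + β (eⱼ − eₖ) + y with y in the cone of the
-- other edges; merging the smaller of α, β into eᵢ − eₖ puts it into the cone of G₁ or G₂.
-- The cones of G₁ and G₂ meet where both coefficients agree, which is the cone of G₃.

open import Defs
open import Algebra.Bundles using (CommutativeMonoid; CommutativeRing)
import Algebra.Properties.AbelianGroup as AbelianGroupProperties
import Algebra.Properties.CommutativeSemigroup as CommutativeSemigroupProperties
import Algebra.Properties.Ring as RingProperties
import Algebra.Properties.Semiring.Sum as SemiringSum
open import Data.Bool.Base using (if_then_else_)
open import Data.Fin.Base using (Fin; zero; suc; _<_; punchIn; punchOut)
open import Data.Fin.Properties
  using (_≟_; <-irrefl; <-asym; punchIn-injective; punchInᵢ≢i; punchIn-punchOut)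
open import Data.List.Base
  using (List; []; _∷_; _∷ʳ_; lookup; filter; allFin; cartesianProduct)
import Data.List.Membership.DecPropositional as DecMembership
open import Data.List.Membership.Propositional using () renaming (_∈_ to _∈ˡ_)
open import Data.List.Membership.Propositional.Properties
  using (∈-filter⁺; ∈-filter⁻; ∈-cartesianProduct⁺; ∈-allFin; ∈-lookup)
open import Data.List.Relation.Unary.All as All using (All; []; _∷_)
open import Data.List.Relation.Unary.All.Properties using (¬Any⇒All¬)
open import Data.List.Relation.Unary.AllPairs using ([]; _∷_)
open import Data.List.Relation.Unary.Any using (here; there; index)
open import Data.List.Relation.Unary.Any.Properties using (lookup-index)
open import Data.List.Relation.Unary.Linked using (Linked; [-]; _∷_)
open import Data.List.Relation.Unary.Unique.Propositional using (Unique)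
open import Data.List.Relation.Unary.Unique.Propositional.Properties
  using (filter⁺; cartesianProduct⁺; allFin⁺)
open import Data.Nat.Base using (ℕ; suc; _∸_; z≤n; s≤s)
open import Data.Product.Base using (_×_; _,_; ∃-syntax; proj₁; proj₂)
open import Data.Product.Properties using (≡-dec)
open import Data.Sum.Base using (_⊎_; inj₁; inj₂)
import Data.Vec.Functional as Vector
open Vector using (Vector; tail)
open import Function.Base using (_∘_; _∘′_; id)
open import Function.Definitions using (Injective)
open import Level using (Level; _⊔_; 0ℓ)
open import Relation.Binary.Construct.Closure.Equivalence as EqC using (EqClosure)
open import Relation.Binary.Construct.Closure.ReflexiveTransitive using (Star; ε; _◅_; _◅◅_)
open import Relation.Binary.Construct.Closure.Symmetric using (SymClosure; fwd; bwd)
open import Relation.Binary.Core using (Rel)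
open import Relation.Binary.Definitions using (DecidableEquality)
open import Relation.Binary.PropositionalEquality as ≡ using (_≡_; _≢_)
import Relation.Binary.Reasoning.Setoid as SetoidReasoning
open import Relation.Binary.Structures using (IsTotalOrder)
open import Relation.Nullary using (¬_; Dec; yes; no; does; contradiction; ¬?)
open import Relation.Nullary.Decidable using (dec-true; dec-false)
open import Relation.Unary using (Pred; _∈_; _⊆_; _≐_; _∪_; _∩_; _∖_; ｛_｝)

-- Walks and simple paths

Pair : ℕ → Set
Pair m = Fin m × Fin m

_≟ₑ_ : ∀ {m} → DecidableEquality (Pair m)
_≟ₑ_ = ≡-dec _≟_ _≟_

-- The list holds the vertices after the first, the end included, so that `u ∷ ws` is the whole
-- vertex sequence, in the format of `start ∷ rest` in `Cycle`.
data Path {m} (R : Rel (Fin m) 0ℓ) : Fin m → List (Fin m) → Fin m → Set where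
  []  : ∀ {u} → Path R u [] u
  _∷_ : ∀ {u w v ws} → R u w → Path R w ws v → Path R u (w ∷ ws) v

SimplePath : ∀ {m} → Rel (Fin m) 0ℓ → Rel (Fin m) 0ℓ
SimplePath R u v = ∃[ ws ] Path R u ws v × Unique (u ∷ ws)

module _ {m : ℕ} {R : Rel (Fin m) 0ℓ} where

  open DecMembership (_≟_ {m}) using (_∈?_)

  suffix : ∀ {u v w ws} → Path R w ws v → Unique (w ∷ ws) → u ∈ˡ w ∷ ws → SimplePath R u v
  suffix p       us       (here ≡.refl) = _ , p , us
  suffix (_ ∷ p) (_ ∷ us) (there u∈)  = suffix p us u∈

  -- Loop erasure from the far end: if the new first vertex already lies on the simplified
  -- remainder, the detour before that occurrence is dropped.
  simplify : ∀ {u v} → Star R u v → SimplePath R u v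
  simplify ε = [] , [] , [] ∷ []
  simplify {u} (_◅_ {j = w} r walk) with simplify walk
  ... | ws , p , us with u ∈? (w ∷ ws)
  ...   | yes u∈ = suffix p us u∈
  ...   | no  u∉ = w ∷ ws , r ∷ p , ¬Any⇒All¬ _ u∉ ∷ us

  linked : ∀ {S : Rel (Fin m) 0ℓ} {u v t ws} → (∀ {x y} → R x y → S x y) →
           Path R u ws v → S v t → Linked S (u ∷ ws ∷ʳ t)
  linked R⇒S []      s = s ∷ [-]
  linked R⇒S (r ∷ p) s = R⇒S r ∷ linked R⇒S p s

-- Connected components of a finite list of edges

Joined : ∀ {m} → List (Pair m) → Rel (Fin m) 0ℓ
Joined L u v = (u , v) ∈ˡ L

record Components {m : ℕ} (L : List (Pair m)) : Set where
  field
    label   : Fin m → Fin m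
    joined  : ∀ {u v} → Joined L u v → label u ≡ label v
    connect : ∀ {u v} → label u ≡ label v → EqClosure (Joined L) u v

-- Edges are added one at a time; a new edge (a , b) relabels the component of a with the label of
-- b. Connectedness thereby becomes a decidable equality of labels, with no choice of walks.
components : ∀ {m} (L : List (Pair m)) → Components L
components [] = record
  { label = id ; joined = λ () ; connect = λ { ≡.refl → ε } }
components ((a , b) ∷ L) = record
  { label = label′ ; joined = joined′ ; connect = λ eq → connect′ (label a ≟ _) (label a ≟ _) eq }
  where
  open Components (components L)
  _∼_ = EqClosure (Joined ((a , b) ∷ L))

  merge : ∀ {l} → Dec (label a ≡ l) → Fin _
  merge {l} (yes _) = label b
  merge {l} (no  _) = l

  label′ : Fin _ → Fin _
  label′ w = merge (label a ≟ label w)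

  joined′ : ∀ {u v} → Joined ((a , b) ∷ L) u v → label′ u ≡ label′ v
  joined′ (here ≡.refl) with label a ≟ label a | label a ≟ label b
  ... | no a≢a | _     = contradiction ≡.refl a≢a
  ... | yes _  | yes _ = ≡.refl
  ... | yes _  | no _  = ≡.refl
  joined′ (there uv∈) = ≡.cong (λ l → merge (label a ≟ l)) (joined uv∈)

  old : ∀ {u v} → label u ≡ label v → u ∼ v
  old = EqC.map there ∘ connect

  a∼b : a ∼ b
  a∼b = EqC.return (here ≡.refl)

  -- The decisions are arguments so that matching on them computes `merge`. If just one of u, v
  -- carried the label of a, the walk has to cross the new edge.
  connect′ : ∀ {u v} (du : Dec (label a ≡ label u)) (dv : Dec (label a ≡ label v)) →
             merge du ≡ merge dv → u ∼ v
  connect′ (yes au) (yes av) _  = old (≡.trans (≡.sym au) av)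
  connect′ (yes au) (no _)   eq = old (≡.sym au) ◅◅ a∼b ◅◅ old eq
  connect′ (no _)   (yes av) eq =
    old eq ◅◅ EqC.symmetric _ a∼b ◅◅ old av
  connect′ (no _)   (no _)   eq = old eq

-- Bridges in acyclic graphs

pairs : ∀ m → List (Pair m)
pairs m = cartesianProduct (allFin m) (allFin m)

∈-pairs : ∀ {m} (e : Pair m) → e ∈ˡ pairs m
∈-pairs (a , b) = ∈-cartesianProduct⁺ (∈-allFin a) (∈-allFin b)

record Bridge {m} (G : Graph m) (a b : Fin m) : Set where
  field
    side     : Fin m → Fin m
    separate : side a ≢ side b
    constant : ∀ {c d} → (c , d) ∈ E G → (c , d) ≢ (a , b) → side c ≡ side d

-- `side` labels the components of the graph without (a , b). If a and b shared a label, a simple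
-- path from b to a avoiding (a , b) would be closed by that edge into a cycle.
acyclic⇒bridge : ∀ {m} {G : Graph m} → Acyclic G → ∀ {a b} → (a , b) ∈ E G → Bridge G a b
acyclic⇒bridge {m} {G} acyclic {a} {b} ab∈ = record
  { side     = label
  ; separate = λ eq → acyclic (close (simplify (connect (≡.sym eq))))
  ; constant = λ cd∈ cd≢ → joined (∈-filter⁺ _ (∈-filter⁺ (E? G) (∈-pairs _) cd∈) cd≢)
  }
  where
  others = filter (λ e → ¬? (e ≟ₑ (a , b))) (filter (E? G) (pairs m))
  open Components (components others)
  R = SymClosure (Joined others)

  other : ∀ {e} → e ∈ˡ others → e ∈ E G × e ≢ (a , b)
  other e∈ with ∈-filter⁻ _ {xs = filter (E? G) (pairs m)} e∈
  ... | e∈′ , e≢ = proj₂ (∈-filter⁻ (E? G) {xs = pairs m} e∈′) , e≢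

  adjacent : ∀ {x y} → R x y → Adjacent G x y
  adjacent (fwd xy∈) = inj₁ (proj₁ (other xy∈))
  adjacent (bwd yx∈) = inj₂ (proj₁ (other yx∈))

  close : SimplePath R b a → Cycle G
  -- A `Cycle` needs two vertices besides its start, so shorter paths are excluded separately:
  -- length 0 would give a = b, and length 1 would use (b , a), which is wrongly ordered, or (a ,
  -- b), which was removed.
  close ([] , [] , _) = contradiction (ordered G ab∈) (<-irrefl ≡.refl)
  close (_ ∷ [] , fwd ba∈ ∷ [] , _) =
    contradiction (ordered G ab∈) (<-asym (ordered G (proj₁ (other ba∈))))
  close (_ ∷ [] , bwd ab∈′ ∷ [] , _) = contradiction ≡.refl (proj₂ (other ab∈′))
  close (u ∷ v ∷ ws , p , us) = record
    { start = b ; rest = u ∷ v ∷ ws ; long = s≤s (s≤s z≤n) ; distinct = us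
    ; closed = linked adjacent p (inj₁ ab∈) }

-- Enumerations of edge sets

lookup-injective : ∀ {A : Set} {xs : List A} → Unique xs → Injective _≡_ _≡_ (lookup xs)
lookup-injective (_ ∷ _)  {zero}  {zero}  _  = ≡.refl
lookup-injective (x∉ ∷ _) {zero}  {suc t} eq = contradiction eq (All.lookup x∉ (∈-lookup t))
lookup-injective (x∉ ∷ _) {suc s} {zero}  eq = contradiction (≡.sym eq) (All.lookup x∉ (∈-lookup s))
lookup-injective (_ ∷ us) {suc s} {suc t} eq = ≡.cong suc (lookup-injective us eq)

-- A bijection with `Fin d`: it fixes the number of edges and also indexes the edge vectors of the
-- future affine basis.
record Enumeration {m} (A : Pred (Pair m) 0ℓ) (d : ℕ) : Set where
  field
    edge      : Fin d → Pair m
    injective : Injective _≡_ _≡_ edge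
    sound     : ∀ t → edge t ∈ A
    complete  : ∀ {e} → e ∈ A → ∃[ t ] edge t ≡ e

enumerate : ∀ {m} (G : Graph m) → Enumeration (E G) (edgeCount G)
enumerate {m} G = record
  { edge      = lookup edges
  ; injective = lookup-injective (filter⁺ (E? G) (cartesianProduct⁺ (allFin⁺ m) (allFin⁺ m)))
  ; sound     = λ t → proj₂ (∈-filter⁻ (E? G) {xs = pairs m} (∈-lookup t))
  ; complete  = λ e∈ → let e∈edges = ∈-filter⁺ (E? G) (∈-pairs _) e∈ in
                       index e∈edges , ≡.sym (lookup-index e∈edges)
  }
  where edges = filter (E? G) (pairs m)

-- Substituting r for q stays injective because r is not already listed, so the count d is
-- unchanged.
replace : ∀ {m d} {A B : Pred (Pair m) 0ℓ} {q r : Pair m} → ¬ r ∈ A → q ∈ A →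
          B ≐ ((A ∖ ｛ q ｝) ∪ ｛ r ｝) → Enumeration A d → Enumeration B d
replace {m} {d} {A} {B} {q} {r} r∉ q∈ (B⊆ , ⊆B) enum = record
  { edge      = swap ∘ edge
  ; injective = λ {s} {t} eq → injective (swap-injective (sound s) (sound t) eq)
  ; sound     = λ t → swap-sound (sound t)
  ; complete  = λ e∈ → find (B⊆ e∈)
  }
  where
  open Enumeration enum

  swap : Pair m → Pair m
  swap e with e ≟ₑ q
  ... | yes _ = r
  ... | no  _ = e

  swap-injective : ∀ {e e′} → e ∈ A → e′ ∈ A → swap e ≡ swap e′ → e ≡ e′
  swap-injective {e} {e′} e∈ e′∈ eq with e ≟ₑ q | e′ ≟ₑ q
  ... | yes ≡.refl | yes ≡.refl = ≡.refl
  ... | yes _    | no _     = contradiction (≡.subst A (≡.sym eq) e′∈) r∉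
  ... | no _     | yes _    = contradiction (≡.subst A eq e∈) r∉
  ... | no _     | no _     = eq

  swap-sound : ∀ {e} → e ∈ A → swap e ∈ B
  swap-sound {e} e∈ with e ≟ₑ q
  ... | yes _  = ⊆B (inj₂ ≡.refl)
  ... | no e≢q = ⊆B (inj₁ (e∈ , e≢q ∘ ≡.sym))

  swap-self : swap q ≡ r
  swap-self with q ≟ₑ q
  ... | yes _  = ≡.refl
  ... | no q≢q = contradiction ≡.refl q≢q

  swap-other : ∀ {e} → q ≢ e → swap e ≡ e
  swap-other {e} q≢e with e ≟ₑ q
  ... | yes ≡.refl = contradiction ≡.refl q≢e
  ... | no _     = ≡.refl

  find : ∀ {e} → e ∈ ((A ∖ ｛ q ｝) ∪ ｛ r ｝) → ∃[ t ] swap (edge t) ≡ e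
  find (inj₁ (e∈ , q≢e)) with complete e∈
  ... | t , ≡.refl = t , swap-other q≢e
  find (inj₂ ≡.refl) with complete q∈
  ... | t , ≡.refl = t , swap-self

remove : ∀ {m d} {A B : Pred (Pair m) 0ℓ} {q : Pair m} → q ∈ A →
         B ≐ (A ∖ ｛ q ｝) → Enumeration A d → Enumeration B (d ∸ 1)
remove {d = d} q∈ _ enum with Enumeration.complete enum q∈
-- The index of q inhabits `Fin d`, so d is a successor and `d ∸ 1` is a genuine predecessor.
remove {d = suc d} {A} {q = q} q∈ (B⊆ , ⊆B) enum | t , ≡.refl = record
  { edge      = edge ∘ punchIn t
  ; injective = λ eq → punchIn-injective t _ _ (injective eq)
  ; sound     = λ s → ⊆B (sound _ , λ eq → punchInᵢ≢i t s (≡.sym (injective eq)))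
  ; complete  = λ e∈ → find (B⊆ e∈)
  }
  where
  open Enumeration enum

  find : ∀ {e} → e ∈ (A ∖ ｛ q ｝) → ∃[ s ] edge (punchIn t s) ≡ e
  find (e∈ , q≢e) with complete e∈
  ... | s , ≡.refl = punchOut t≢s , ≡.cong edge (punchIn-punchOut t≢s)
    where
    t≢s : t ≢ s
    t≢s = q≢e ∘ ≡.cong edge

module Reduction {c ℓ₁ ℓ₂ : Level} (F : OrderedField c ℓ₁ ℓ₂) where

  open OrderedField F
  open CommutativeRing commutativeRing
    using ( refl; sym; trans; reflexive; +-cong; +-congˡ; +-congʳ; +-assoc; +-comm
          ; +-identityˡ; +-identityʳ; -‿cong; -‿inverseˡ; -‿inverseʳ; *-congˡ; *-congʳ; *-assoc
          ; *-identityˡ; *-identityʳ; zeroˡ; zeroʳ; distribˡ; distribʳ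
          ; ring; semiring; +-abelianGroup; +-commutativeMonoid; *-commutativeMonoid)
  open RingProperties ring using (-0#≈0#; -1*x≈-x; -‿involutive)
  open AbelianGroupProperties +-abelianGroup using (⁻¹-∙-comm)
    renaming ( ∙-cancelʳ to +-cancelʳ
             ; x∙y⁻¹≈ε⇒x≈y to x-y≈0⇒x≈y
             ; x≈y⇒x∙y⁻¹≈ε to x≈y⇒x-y≈0)
  open RootPolytope F
  open SemiringSum semiring
    using (sum-cong-≋; sum-replicate-zero; sum-remove; ∑-distrib-+; *-distribˡ-sum)
  open CommutativeSemigroupProperties (CommutativeMonoid.commutativeSemigroup +-commutativeMonoid)
    using (x∙yz≈y∙xz; interchange)
  open CommutativeSemigroupProperties (CommutativeMonoid.commutativeSemigroup *-commutativeMonoid)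
    using () renaming (x∙yz≈y∙xz to *-x∙yz≈y∙xz)
  open IsTotalOrder isTotalOrder using (total; antisym; ≤-respʳ-≈; ≤-respˡ-≈)
    renaming (trans to ≤-trans; reflexive to ≤-reflexive)
  open SetoidReasoning setoid

  -- Arithmetic in an ordered field

  telescope : ∀ x y z → x - z ≈ (x - y) + (y - z)
  telescope x y z = begin
    x - z                 ≈⟨ +-congˡ (+-identityˡ _) ⟨
    x + (0# - z)          ≈⟨ +-congˡ (+-congʳ (-‿inverseˡ y)) ⟨
    x + ((- y + y) - z)   ≈⟨ +-congˡ (+-assoc _ _ _) ⟩
    x + (- y + (y - z))   ≈⟨ +-assoc _ _ _ ⟨
    (x - y) + (y - z)     ∎

  0≤x+y : ∀ {x y} → 0# ≤ x → 0# ≤ y → 0# ≤ (x + y)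
  0≤x+y 0≤x 0≤y = ≤-trans 0≤x (≤-respˡ-≈ (+-identityʳ _) (+-monoʳ-≤ _ 0≤y))

  0≤y-x : ∀ {x y} → x ≤ y → 0# ≤ (y - x)
  0≤y-x x≤y = ≤-respʳ-≈ (+-comm _ _) (≤-respˡ-≈ (-‿inverseˡ _) (+-monoʳ-≤ _ x≤y))

  -- If 1 ≤ 0 then -1 is nonnegative, and so is its square, which is 1.
  0≤1 : 0# ≤ 1#
  0≤1 with total 0# 1#
  ... | inj₁ 0≤1 = 0≤1
  ... | inj₂ 1≤0 = ≤-respʳ-≈ (trans (-1*x≈-x _) (-‿involutive 1#)) (*-nonNegative 0≤-1 0≤-1)
    where
    0≤-1 : 0# ≤ (- 1#)
    0≤-1 = ≤-respʳ-≈ (+-identityˡ _) (0≤y-x 1≤0)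

  x+y≈0⇒x≈0 : ∀ {x y} → 0# ≤ x → 0# ≤ y → x + y ≈ 0# → x ≈ 0#
  x+y≈0⇒x≈0 0≤x 0≤y x+y≈0 =
    antisym (≤-respʳ-≈ x+y≈0 (≤-respˡ-≈ (+-identityʳ _) (+-monoʳ-≤ _ 0≤y))) 0≤x

  -- Potentials and dual systems

  Potential : ℕ → Set c
  Potential = Vector Carrier

  -- The value on e_a - e_b of the linear functional with coefficients φ; `pair-root` makes this
  -- precise.
  drop : ∀ {m} → Potential m → Pair m → Carrier
  drop φ (a , b) = φ a - φ b

  -- A system biorthogonal to the edge vectors. It replaces acyclicity as the working notion because
  -- it passes to subsets and behaves linearly under an exchange of edges.
  DualSystem : ∀ {m} → Pred (Pair m) 0ℓ → Set (c ⊔ ℓ₁)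
  DualSystem A = ∀ {p} → p ∈ A →
    ∃[ φ ] (drop φ p ≈ 1#) × (∀ {q} → q ∈ A → p ≢ q → drop φ q ≈ 0#)

  1-0≈1 : 1# - 0# ≈ 1#
  1-0≈1 = trans (+-congˡ -0#≈0#) (+-identityʳ _)

  -- The potential is the indicator of the side of a, which changes only across the bridge.
  acyclic⇒dual : ∀ {m} {G : Graph m} → Acyclic G → DualSystem (E G)
  acyclic⇒dual acyclic {a , b} ab∈ = φ , separated , λ q∈ ab≢q → flat (constant q∈ (ab≢q ∘ ≡.sym))
    where
    open Bridge (acyclic⇒bridge acyclic ab∈)

    indicator : Fin _ → Carrier
    indicator l = if does (l ≟ side a) then 1# else 0#

    φ : Potential _
    φ = indicator ∘ side

    separated : φ a - φ b ≈ 1#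
    separated rewrite dec-true (side a ≟ side a) ≡.refl
                    | dec-false (side b ≟ side a) (separate ∘ ≡.sym) = 1-0≈1

    flat : ∀ {c d} → side c ≡ side d → φ c - φ d ≈ 0#
    flat eq = x≈y⇒x-y≈0 (reflexive (≡.cong indicator eq))

  -- The potential dual to the first edge of a cycle is constant along all its other edges, hence
  -- equal at both ends of the first one, where it should differ by 1.
  dual⇒acyclic : ∀ {m} {G : Graph m} → DualSystem (E G) → Acyclic G
  dual⇒acyclic dual record { rest = [] ; long = () }
  dual⇒acyclic dual record { rest = _ ∷ [] ; long = s≤s () }
  dual⇒acyclic {m} {G} dual record
    { start = s ; rest = u ∷ v ∷ ws
    ; distinct = (s≢u ∷ s≢v ∷ _) ∷ (u≢vws ∷ _) ; closed = su ∷ uv ∷ closed } = no-return su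
    where
    -- The first edge is stored as (s , u) or as (u , s), so both orientations are excluded and the
    -- argument serves either case.
    module _ (φ : Potential m)
             (flat : ∀ {x y} → (x , y) ∈ E G → (s , u) ≢ (x , y) →
                     (u , s) ≢ (x , y) → drop φ (x , y) ≈ 0#)
             where

      level : ∀ {x y} → Adjacent G x y → (s , u) ≢ (x , y) → (u , s) ≢ (x , y) → φ x ≈ φ y
      level (inj₁ xy) ≢su ≢us = x-y≈0⇒x≈y _ _ (flat xy ≢su ≢us)
      level (inj₂ yx) ≢su ≢us = sym (x-y≈0⇒x≈y _ _ (flat yx
        (≢us ∘ λ { ≡.refl → ≡.refl }) (≢su ∘ λ { ≡.refl → ≡.refl })))

      -- No step from v back to s uses the edge between s and u, since u does not occur among the
      -- vertices visited.
      return : ∀ x xs → All (u ≢_) (x ∷ xs) → Linked (Adjacent G) (x ∷ xs ∷ʳ s) → φ x ≈ φ s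
      return x [] (u≢x ∷ _) (xs ∷ _) = level xs
        (λ { ≡.refl → s≢u ≡.refl }) (λ { ≡.refl → u≢x ≡.refl })
      return x (y ∷ ys) (u≢x ∷ u≢ys) (xy ∷ yss) = trans
        (level xy (λ { ≡.refl → All.head u≢ys ≡.refl }) (λ { ≡.refl → u≢x ≡.refl }))
        (return y ys u≢ys yss)

      φu≈φs : φ u ≈ φ s
      φu≈φs = trans (level uv (λ { ≡.refl → s≢u ≡.refl }) (λ { ≡.refl → s≢v ≡.refl }))
        (return v ws u≢vws closed)

    no-return : ¬ Adjacent G s u
    no-return (inj₁ su∈) with dual su∈
    ... | φ , one , flat = 0≉1 (trans
      (sym (x≈y⇒x-y≈0 (sym (φu≈φs φ λ xy∈ su≢ _ → flat xy∈ su≢)))) one)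
    no-return (inj₂ us∈) with dual us∈
    ... | φ , one , flat = 0≉1 (trans
      (sym (x≈y⇒x-y≈0 (φu≈φs φ λ xy∈ _ us≢ → flat xy∈ us≢))) one)

  module _ {m : ℕ} {A : Pred (Pair m) 0ℓ} {p q r : Pair m} (dual : DualSystem A)
           (p∈ : p ∈ A) (q∈ : q ∈ A) (p≢q : p ≢ q)
           (drop-r : ∀ φ → drop φ r ≈ drop φ p + drop φ q) where

    -- The potential dual to p drops by 1 + 0 on r, yet would have to vanish on a member r other
    -- than p; if r is p, the one dual to q gives the contradiction. For edges this rules out the
    -- triangle i, j, k.
    sum-∉ : ¬ r ∈ A
    sum-∉ r∈ with r ≟ₑ p
    ... | no r≢p with dual p∈
    ...   | φ , one , flat = 0≉1 (begin
      0#                    ≈⟨ flat r∈ (r≢p ∘ ≡.sym) ⟨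
      drop φ r              ≈⟨ drop-r φ ⟩
      drop φ p + drop φ q   ≈⟨ +-cong one (flat q∈ p≢q) ⟩
      1# + 0#               ≈⟨ +-identityʳ _ ⟩
      1#                    ∎)
    sum-∉ r∈ | yes ≡.refl with dual q∈
    ... | φ , one , flat = 0≉1 (begin
      0#                    ≈⟨ flat p∈ (p≢q ∘ ≡.sym) ⟨
      drop φ r              ≈⟨ drop-r φ ⟩
      drop φ p + drop φ q   ≈⟨ +-cong (flat p∈ (p≢q ∘ ≡.sym)) one ⟩
      0# + 1#               ≈⟨ +-identityˡ _ ⟩
      1#                    ∎)

    -- The new r inherits the potential of q. Members other than p and q keep theirs, which vanishes
    -- on p and q and hence on r. The potential of p drops by 1 on r, which subtracting that of q
    -- corrects.
    exchange : ∀ {B} → B ⊆ ((A ∖ ｛ q ｝) ∪ ｛ r ｝) → DualSystem B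
    exchange {B} B⊆ e∈ = go (B⊆ e∈)
      where
      extend : ∀ {e} φ → (∀ {f} → f ∈ (A ∖ ｛ q ｝) → e ≢ f → drop φ f ≈ 0#) →
               (e ≢ r → drop φ p + drop φ q ≈ 0#) → ∀ {f} → f ∈ B → e ≢ f → drop φ f ≈ 0#
      extend φ flat flat-r f∈ e≢f with B⊆ f∈
      ... | inj₁ f∈A    = flat f∈A e≢f
      ... | inj₂ ≡.refl = trans (drop-r φ) (flat-r e≢f)

      go : ∀ {e} → e ∈ ((A ∖ ｛ q ｝) ∪ ｛ r ｝) →
           ∃[ φ ] (drop φ e ≈ 1#) × (∀ {f} → f ∈ B → e ≢ f → drop φ f ≈ 0#)
      go (inj₂ ≡.refl) with dual q∈
      ... | φ , one , flat =
        φ ,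
        trans (drop-r φ) (trans (+-cong (flat p∈ (p≢q ∘ ≡.sym)) one) (+-identityˡ _)) ,
        extend φ (λ (f∈ , q≢f) _ → flat f∈ q≢f) (contradiction ≡.refl)
      go {e} (inj₁ (e∈ , q≢e)) with e ≟ₑ p
      ... | no e≢p with dual e∈
      ...   | φ , one , flat =
        φ , one ,
        extend φ (λ (f∈ , _) → flat f∈)
          (λ _ → trans (+-cong (flat p∈ e≢p) (flat q∈ (q≢e ∘ ≡.sym))) (+-identityˡ _))
      go (inj₁ _) | yes ≡.refl with dual p∈ | dual q∈
      ... | φ , φ-one , φ-flat | ψ , ψ-one , ψ-flat =
        χ , trans (drop-χ p) (trans (+-cong φ-one (-‿cong (ψ-flat p∈ (p≢q ∘ ≡.sym)))) 1-0≈1) ,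
        extend χ
          (λ (f∈ , q≢f) p≢f → trans (drop-χ _)
            (trans (+-cong (φ-flat f∈ p≢f) (-‿cong (ψ-flat f∈ q≢f))) (-‿inverseʳ 0#)))
          (λ _ → begin
            drop χ p + drop χ q
              ≈⟨ +-cong (drop-χ p) (drop-χ q) ⟩
            (drop φ p - drop ψ p) + (drop φ q - drop ψ q)
              ≈⟨ +-cong (+-cong φ-one (-‿cong (ψ-flat p∈ (p≢q ∘ ≡.sym))))
                        (+-cong (φ-flat q∈ p≢q) (-‿cong ψ-one)) ⟩
            (1# - 0#) + (0# - 1#)
              ≈⟨ telescope 1# 0# 1# ⟨
            1# - 1#
              ≈⟨ -‿inverseʳ 1# ⟩
            0# ∎)
        where
        χ : Potential m
        χ a = φ a - ψ a

        drop-χ : ∀ f → drop χ f ≈ drop φ f - drop ψ f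
        drop-χ (a , b) = begin
          (φ a - ψ a) - (φ b - ψ b)        ≈⟨ +-congˡ (⁻¹-∙-comm _ _) ⟨
          (φ a - ψ a) + (- φ b - (- ψ b))  ≈⟨ interchange _ _ _ _ ⟩
          (φ a - φ b) + (- ψ a - (- ψ b))  ≈⟨ +-congˡ (⁻¹-∙-comm _ _) ⟩
          (φ a - φ b) - (ψ a - ψ b)        ∎

  -- Cones generated by roots

  private variable
    m d : ℕ
    ℓ : Level
    γ : Carrier
    x z : Point m
    A B : Pred (Pair m) 0ℓ
    p q r : Pair m

  infixr 6 _⊕_
  infixr 7 _·_

  _⊕_ : Point m → Point m → Point m
  (x ⊕ y) a = x a + y a

  _·_ : Carrier → Point m → Point m
  (α · x) a = α * x a

  rootₚ : Pair m → Point m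
  rootₚ (i , j) = root i j

  Roots : Pred (Pair m) 0ℓ → Pred (Point m) ℓ₁
  Roots A x = ∃[ i ] ∃[ j ] ((i , j) ∈ A) × (x ≋ root i j)

  -- A nonempty `combination` unfolds by computation to its first term plus the rest; this one
  -- induction serves both cones and spans.
  combination-elim : (P : Pred (Point m) ℓ) → P origin →
                     ∀ {k} (w : Vector Carrier k) (v : Vector (Point m) k) →
                     (∀ t {y} → P y → P (w t · v t ⊕ y)) → P (combination w v)
  combination-elim P P0 {0}     w v step = P0
  combination-elim P P0 {suc k} w v step =
    step zero (combination-elim P P0 (tail w) (tail v) (step ∘ suc))

  -- An inductive form of Cone, which allows pattern matching on the generators in use.
  data Conical {m : ℕ} {ℓ : Level} (S : Pred (Point m) ℓ) (x : Point m) : Set (c ⊔ ℓ₁ ⊔ ℓ₂ ⊔ ℓ) where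
    nil  : x ≋ origin → Conical S x
    cons : ∀ {α s y} → 0# ≤ α → s ∈ S → y ∈ Conical S → x ≋ (α · s ⊕ y) → Conical S x

  Conical-resp : {S : Pred (Point m) ℓ} → x ≋ z → z ∈ Conical S → x ∈ Conical S
  Conical-resp x≋z (nil z≋)            = nil (λ a → trans (x≋z a) (z≋ a))
  Conical-resp x≋z (cons 0≤α s∈ y∈ z≋) = cons 0≤α s∈ y∈ (λ a → trans (x≋z a) (z≋ a))

  Cone⊆Conical : (S : Pred (Point m) ℓ) → Cone S ⊆ Conical S
  Cone⊆Conical S (_ , w , v , v∈ , 0≤w , x≋) = Conical-resp x≋
    (combination-elim (Conical S) (nil λ _ → refl) w v λ t y∈ → cons (0≤w t) (v∈ t) y∈ λ _ → refl)

  Conical⊆Cone : (S : Pred (Point m) ℓ) → Conical S ⊆ Cone S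
  Conical⊆Cone S (nil x≋) = 0 , (λ ()) , (λ ()) , (λ ()) , (λ ()) , x≋
  Conical⊆Cone S (cons {α} {s} 0≤α s∈ y∈ x≋) with Conical⊆Cone S y∈
  ... | k , w , v , v∈ , 0≤w , y≋ =
    suc k , α Vector.∷ w , s Vector.∷ v ,
    (λ { zero → s∈ ; (suc t) → v∈ t }) , (λ { zero → 0≤α ; (suc t) → 0≤w t }) ,
    λ a → trans (x≋ a) (+-congˡ (y≋ a))

  Conical-mono : ∀ {ℓ′} {S : Pred (Point m) ℓ} {T : Pred (Point m) ℓ′} →
                 S ⊆ T → Conical S ⊆ Conical T
  Conical-mono S⊆T (nil x≋)            = nil x≋
  Conical-mono S⊆T (cons 0≤α s∈ y∈ x≋) = cons 0≤α (S⊆T s∈) (Conical-mono S⊆T y∈) x≋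

  Roots-mono : A ⊆ B → Roots A ⊆ Roots B
  Roots-mono A⊆B (i , j , ij∈ , x≋) = i , j , A⊆B ij∈ , x≋

  gen∈Conv : (S : Pred (Point m) ℓ) (x : Point m) → x ∈ S → x ∈ Conv S
  gen∈Conv S x x∈ = 1 , (λ _ → 1#) , (λ _ → x) , (λ _ → x∈) , (λ _ → 0≤1) ,
    +-identityʳ 1# , λ a → sym (trans (+-identityʳ _) (*-identityˡ (x a)))

  gen∈Conical : {S : Pred (Point m) ℓ} → S ⊆ Conical S
  gen∈Conical x∈ = cons 0≤1 x∈ (nil λ _ → refl) λ a → sym (trans (+-identityʳ _) (*-identityˡ _))

  collect : ∀ α β x z → α * x + (β * x + z) ≈ (α + β) * x + z
  collect α β x z = trans (sym (+-assoc _ _ _)) (+-congʳ (sym (distribʳ x α β)))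

  record Split {m : ℕ} (p q : Pair m) (B : Pred (Pair m) 0ℓ) (x : Point m) : Set (c ⊔ ℓ₁ ⊔ ℓ₂) where
    field
      {α β}  : Carrier
      {y}    : Point m
      0≤α    : 0# ≤ α
      0≤β    : 0# ≤ β
      y∈     : y ∈ Conical (Roots B)
      x≋     : x ≋ (α · rootₚ p ⊕ β · rootₚ q ⊕ y)

  -- Generators may repeat in a conic combination: occurrences of p and q accumulate in α and β, and
  -- all others go into y.
  split : (∀ {e} → e ∈ A → e ≡ p ⊎ e ≡ q ⊎ e ∈ B) → Conical (Roots A) ⊆ Split p q B
  split cover (nil x≋) = record
    { 0≤α = ≤-reflexive refl ; 0≤β = ≤-reflexive refl ; y∈ = nil λ _ → refl
    ; x≋ = λ a → trans (x≋ a) (sym (trans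
        (+-cong (zeroˡ _) (trans (+-congʳ (zeroˡ _)) (+-identityˡ 0#))) (+-identityˡ 0#))) }
  split {p = p} {q} cover (cons {γ} 0≤γ (i , j , ij∈ , s≋) y∈ x≋) with split cover y∈ | cover ij∈
  ... | sp | inj₁ ≡.refl = record { Split sp hiding (α) ; α = γ + α ; 0≤α = 0≤x+y 0≤γ 0≤α
      ; x≋ = λ a → trans (x≋ a) (trans (+-cong (*-congˡ (s≋ a)) (y≋ a)) (collect γ α (rootₚ p a) _)) }
    where open Split sp renaming (x≋ to y≋)
  ... | sp | inj₂ (inj₁ ≡.refl) = record { Split sp hiding (β) ; β = γ + β ; 0≤β = 0≤x+y 0≤γ 0≤β
      ; x≋ = λ a → trans (x≋ a) (trans (+-cong (*-congˡ (s≋ a)) (y≋ a))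
               (trans (x∙yz≈y∙xz _ _ _) (+-congˡ (collect γ β (rootₚ q a) _)))) }
    where open Split sp renaming (x≋ to y≋)
  ... | sp | inj₂ (inj₂ ij∈B) = record { Split sp hiding (y; y∈)
      ; y∈ = cons 0≤γ (i , j , ij∈B , λ _ → refl) (Split.y∈ sp) λ _ → refl
      ; x≋ = λ a → trans (x≋ a) (trans (+-cong (*-congˡ (s≋ a)) (y≋ a))
               (trans (x∙yz≈y∙xz _ _ _) (+-congˡ (x∙yz≈y∙xz _ _ _)))) }
    where open Split sp using () renaming (x≋ to y≋)

  unsplit : p ∈ A → q ∈ A → B ⊆ A → Split p q B ⊆ Conical (Roots A)
  unsplit p∈ q∈ B⊆A s =
    cons 0≤α (_ , _ , p∈ , λ _ → refl)
      (cons 0≤β (_ , _ , q∈ , λ _ → refl) (Conical-mono (Roots-mono B⊆A) y∈) λ _ → refl) x≋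
    where open Split s

  swap : Split p q B ⊆ Split q p B
  swap s = record
    { 0≤α = 0≤β ; 0≤β = 0≤α ; y∈ = y∈ ; x≋ = λ a → trans (x≋ a) (x∙yz≈y∙xz _ _ _) }
    where open Split s

  module _ {p q r : Pair m} (r≋p⊕q : rootₚ r ≋ (rootₚ p ⊕ rootₚ q)) where

    regroup : ∀ α β y → (α · rootₚ p ⊕ β · rootₚ r ⊕ y) ≋ ((α + β) · rootₚ p ⊕ β · rootₚ q ⊕ y)
    regroup α β y a = begin
      α * rootₚ p a + (β * rootₚ r a + y a)
        ≈⟨ +-congˡ (+-congʳ (trans (*-congˡ (r≋p⊕q a)) (distribˡ _ _ _))) ⟩
      α * rootₚ p a + ((β * rootₚ p a + β * rootₚ q a) + y a)
        ≈⟨ +-congˡ (+-assoc _ _ _) ⟩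
      α * rootₚ p a + (β * rootₚ p a + (β * rootₚ q a + y a))
        ≈⟨ collect α β (rootₚ p a) _ ⟩
      (α + β) * rootₚ p a + (β * rootₚ q a + y a) ∎

    -- With r the sum of p and q as vectors, αp + βq = (α - β)p + βr, and β ≤ α keeps the new
    -- coefficient nonnegative.
    merge : (s : Split p q B x) → Split.β s ≤ Split.α s → Split p r B x
    merge s β≤α = record { 0≤α = 0≤y-x β≤α ; 0≤β = 0≤β ; y∈ = y∈ ; x≋ = λ a → begin
      _
        ≈⟨ x≋ a ⟩
      α * rootₚ p a + (β * rootₚ q a + y a)
        ≈⟨ +-congʳ (*-congʳ (trans (+-assoc _ _ _) (trans (+-congˡ (-‿inverseˡ β)) (+-identityʳ α)))) ⟨
      ((α - β) + β) * rootₚ p a + (β * rootₚ q a + y a)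
        ≈⟨ regroup (α - β) β y a ⟨
      (α - β) * rootₚ p a + (β * rootₚ r a + y a) ∎ }
      where open Split s

    unmerge : Split p r B ⊆ Split p q B
    unmerge s = record { 0≤α = 0≤x+y 0≤α 0≤β ; 0≤β = 0≤β ; y∈ = y∈ ; x≋ = λ a →
      trans (x≋ a) (regroup α β y a) }
      where open Split s

  -- Pairing potentials with points

  ⟨_,_⟩ : Potential m → Point m → Carrier
  ⟨ φ , x ⟩ = sum (λ a → φ a * x a)

  sum-single : (g : Vector Carrier m) (t : Fin m) → (∀ s → t ≢ s → g s ≈ 0#) → sum g ≈ g t
  sum-single {m = suc m} g t zeros = begin
    sum g                                ≈⟨ sum-remove g ⟩
    g t + sum (λ s → g (punchIn t s))    ≈⟨ +-congˡ (sum-cong-≋ λ s → zeros _ (punchInᵢ≢i t s ∘ ≡.sym)) ⟩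
    g t + sum (Vector.replicate m 0#)    ≈⟨ +-congˡ (sum-replicate-zero m) ⟩
    g t + 0#                             ≈⟨ +-identityʳ _ ⟩
    g t                                  ∎

  pair-e : (φ : Potential m) (i : Fin m) → ⟨ φ , e i ⟩ ≈ φ i
  pair-e φ i = trans (sum-single (λ a → φ a * e i a) i off) on
    where
    off : ∀ a → i ≢ a → φ a * e i a ≈ 0#
    off a i≢a rewrite dec-false (i ≟ a) i≢a = zeroʳ _

    on : φ i * e i i ≈ φ i
    on rewrite dec-true (i ≟ i) ≡.refl = *-identityʳ _

  pair-cong : (φ : Potential m) → x ≋ z → ⟨ φ , x ⟩ ≈ ⟨ φ , z ⟩
  pair-cong φ x≋z = sum-cong-≋ (λ a → *-congˡ (x≋z a))

  pair-origin : (φ : Potential m) → ⟨ φ , origin ⟩ ≈ 0#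
  pair-origin {m} φ = trans (sum-cong-≋ λ a → zeroʳ (φ a)) (sum-replicate-zero m)

  pair-⊕ : (φ : Potential m) (x y : Point m) → ⟨ φ , x ⊕ y ⟩ ≈ ⟨ φ , x ⟩ + ⟨ φ , y ⟩
  pair-⊕ φ x y = trans (sum-cong-≋ λ a → distribˡ (φ a) (x a) (y a))
    (∑-distrib-+ (λ a → φ a * x a) (λ a → φ a * y a))

  pair-· : (φ : Potential m) (α : Carrier) (x : Point m) → ⟨ φ , α · x ⟩ ≈ α * ⟨ φ , x ⟩
  pair-· φ α x = trans (sum-cong-≋ λ a → *-x∙yz≈y∙xz (φ a) α (x a))
    (sym (*-distribˡ-sum α (λ a → φ a * x a)))

  pair-root : (φ : Potential m) (p : Pair m) → ⟨ φ , rootₚ p ⟩ ≈ drop φ p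
  pair-root φ (i , j) = begin
    ⟨ φ , e i ⊕ (-_ ∘ e j) ⟩              ≈⟨ pair-⊕ φ (e i) (-_ ∘ e j) ⟩
    ⟨ φ , e i ⟩ + ⟨ φ , -_ ∘ e j ⟩        ≈⟨ +-congˡ (pair-cong φ λ a → -1*x≈-x (e j a)) ⟨
    ⟨ φ , e i ⟩ + ⟨ φ , (- 1#) · e j ⟩    ≈⟨ +-congˡ (trans (pair-· φ (- 1#) (e j)) (-1*x≈-x _)) ⟩
    ⟨ φ , e i ⟩ - ⟨ φ , e j ⟩             ≈⟨ +-cong (pair-e φ i) (-‿cong (pair-e φ j)) ⟩
    φ i - φ j                             ∎

  pair-combination : (φ : Potential m) {k : ℕ} (w : Vector Carrier k) (v : Vector (Point m) k) →
                     ⟨ φ , combination w v ⟩ ≈ sum (λ t → w t * ⟨ φ , v t ⟩)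
  pair-combination φ {0}     w v = pair-origin φ
  pair-combination φ {suc k} w v = begin
    ⟨ φ , w zero · v zero ⊕ combination (tail w) (tail v) ⟩
      ≈⟨ pair-⊕ φ (w zero · v zero) (combination (tail w) (tail v)) ⟩
    ⟨ φ , w zero · v zero ⟩ + ⟨ φ , combination (tail w) (tail v) ⟩
      ≈⟨ +-cong (pair-· φ (w zero) (v zero)) (pair-combination φ (tail w) (tail v)) ⟩
    w zero * ⟨ φ , v zero ⟩ + sum (λ t → w (suc t) * ⟨ φ , v (suc t) ⟩) ∎

  pair-Conical : (φ : Potential m) → (∀ {e} → e ∈ A → drop φ e ≈ 0#) →
                 z ∈ Conical (Roots A) → ⟨ φ , z ⟩ ≈ 0#
  pair-Conical φ flat (nil z≋) = trans (pair-cong φ z≋) (pair-origin φ)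
  pair-Conical {z = z} φ flat (cons {α} {s} {y} _ (i , j , ij∈ , s≋) y∈ z≋) = begin
    ⟨ φ , z ⟩                   ≈⟨ pair-cong φ z≋ ⟩
    ⟨ φ , α · s ⊕ y ⟩           ≈⟨ pair-⊕ φ (α · s) y ⟩
    ⟨ φ , α · s ⟩ + ⟨ φ , y ⟩   ≈⟨ +-cong (pair-· φ α s) (pair-Conical φ flat y∈) ⟩
    α * ⟨ φ , s ⟩ + 0#          ≈⟨ +-identityʳ _ ⟩
    α * ⟨ φ , s ⟩               ≈⟨ *-congˡ (trans (pair-cong φ s≋) (trans (pair-root φ (i , j)) (flat ij∈))) ⟩
    α * 0#                      ≈⟨ zeroʳ α ⟩
    0#                          ∎

  pair-split : (φ : Potential m) → (∀ {e} → e ∈ B → drop φ e ≈ 0#) → (s : Split p q B x) →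
               ⟨ φ , x ⟩ ≈ Split.α s * drop φ p + Split.β s * drop φ q
  pair-split {p = p} {q = q} {x = x} φ flat s = begin
    ⟨ φ , x ⟩
      ≈⟨ pair-cong φ x≋ ⟩
    ⟨ φ , α · rootₚ p ⊕ β · rootₚ q ⊕ y ⟩
      ≈⟨ trans (pair-⊕ φ (α · rootₚ p) (β · rootₚ q ⊕ y)) (+-congˡ (pair-⊕ φ (β · rootₚ q) y)) ⟩
    ⟨ φ , α · rootₚ p ⟩ + (⟨ φ , β · rootₚ q ⟩ + ⟨ φ , y ⟩)
      ≈⟨ +-cong (pair-term α p)
           (trans (+-cong (pair-term β q) (pair-Conical φ flat y∈)) (+-identityʳ _)) ⟩
    α * drop φ p + β * drop φ q ∎
    where
    open Split s
    pair-term : ∀ α p → ⟨ φ , α · rootₚ p ⟩ ≈ α * drop φ p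
    pair-term α p = trans (pair-· φ α (rootₚ p)) (*-congˡ (pair-root φ p))

  -- Spans, affine hulls and dimension

  Span : ∀ {k} → Vector (Point m) k → Pred (Point m) (c ⊔ ℓ₁)
  Span v x = ∃[ w ] (x ≋ combination w v)

  module _ {k : ℕ} {v : Vector (Point m) k} where

    Span-resp : x ≋ z → z ∈ Span v → x ∈ Span v
    Span-resp x≋z (w , z≋) = w , λ a → trans (x≋z a) (z≋ a)

    Span-origin : origin ∈ Span v
    Span-origin = (λ _ → 0#) , λ a →
      sym (trans (sum-cong-≋ λ t → zeroˡ (v t a)) (sum-replicate-zero k))

    Span-gen : ∀ t → v t ∈ Span v
    Span-gen t = (λ s → if does (t ≟ s) then 1# else 0#) , λ a → sym (trans (sum-single _ t (off a)) (on a))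
      where
      off : ∀ a s → t ≢ s → (if does (t ≟ s) then 1# else 0#) * v s a ≈ 0#
      off a s t≢s rewrite dec-false (t ≟ s) t≢s = zeroˡ _

      on : ∀ a → (if does (t ≟ t) then 1# else 0#) * v t a ≈ v t a
      on a rewrite dec-true (t ≟ t) ≡.refl = *-identityˡ _

    Span-cons : ∀ α → x ∈ Span v → z ∈ Span v → (α · x ⊕ z) ∈ Span v
    Span-cons {x} {z} α (w , x≋) (w′ , z≋) = (λ t → α * w t + w′ t) , λ a → begin
      α * x a + z a
        ≈⟨ +-cong (*-congˡ (x≋ a)) (z≋ a) ⟩
      α * sum (λ t → w t * v t a) + sum (λ t → w′ t * v t a)
        ≈⟨ +-congʳ (*-distribˡ-sum α (λ t → w t * v t a)) ⟩
      sum (λ t → α * (w t * v t a)) + sum (λ t → w′ t * v t a)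
        ≈⟨ ∑-distrib-+ (λ t → α * (w t * v t a)) (λ t → w′ t * v t a) ⟨
      sum (λ t → α * (w t * v t a) + w′ t * v t a)
        ≈⟨ sum-cong-≋ (λ t → trans (+-congʳ (sym (*-assoc _ _ _)))
             (sym (distribʳ (v t a) (α * w t) (w′ t)))) ⟩
      sum (λ t → (α * w t + w′ t) * v t a) ∎

    Aff⊆Span : (S : Pred (Point m) ℓ) → S ⊆ Span v → Aff S ⊆ Span v
    Aff⊆Span S S⊆ (_ , w , u , u∈ , _ , x≋) =
      Span-resp x≋ (combination-elim (Span v) Span-origin w u λ t → Span-cons (w t) (S⊆ (u∈ t)))

    -- The origin absorbs whatever weight is missing from 1.
    Span⊆Aff : Span v ⊆ Aff (Range (origin Vector.∷ v))
    Span⊆Aff (w , x≋) =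
      suc k , (1# - sum w) Vector.∷ w , origin Vector.∷ v , (λ t → t , λ _ → refl) ,
      trans (+-assoc _ _ _) (trans (+-congˡ (-‿inverseˡ _)) (+-identityʳ 1#)) ,
      λ a → trans (x≋ a) (sym (trans (+-congʳ (zeroʳ _)) (+-identityˡ _)))

  LinearlyIndependent : ∀ {k} → Vector (Point m) k → Set (c ⊔ ℓ₁)
  LinearlyIndependent v = ∀ w → combination w v ≋ origin → ∀ t → w t ≈ 0#

  Aff-Range-mono : ∀ {k} (b : Vector (Point m) k) (S : Pred (Point m) ℓ) →
                   (∀ t → b t ∈ S) → Aff (Range b) ⊆ Aff S
  Aff-Range-mono b S b∈ (k , w , u , u∈ , sum≈1 , x≋) =
    k , w , b ∘ proj₁ ∘ u∈ , b∈ ∘ proj₁ ∘ u∈ , sum≈1 ,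
    λ a → trans (x≋ a) (sum-cong-≋ λ t → *-congˡ (proj₂ (u∈ t) a))

  -- The origin contributes nothing to a combination, so linear independence kills the other
  -- weights, and the vanishing weight sum then kills its own. Both affine hulls equal the span of
  -- v.
  dimension : (S : Pred (Point m) ℓ) (v : Vector (Point m) d) → LinearlyIndependent v →
              origin ∈ S → (∀ t → v t ∈ S) → S ⊆ Span v → HasDimension S d
  dimension {d = d} S v independent 0∈ v∈ S⊆ =
    origin Vector.∷ v , affine ,
    Aff-Range-mono (origin Vector.∷ v) S (λ { zero → 0∈ ; (suc t) → v∈ t }) ,
    Span⊆Aff ∘′ Aff⊆Span S S⊆
    where
    affine : AffinelyIndependent (origin Vector.∷ v)
    affine w sum≈0 comb≈0 = λ { zero → head≈0 ; (suc t) → tail≈0 t }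
      where
      tail≈0 : ∀ t → w (suc t) ≈ 0#
      tail≈0 = independent (tail w) λ a →
        trans (sym (trans (+-congʳ (zeroʳ _)) (+-identityˡ _))) (comb≈0 a)

      head≈0 : w zero ≈ 0#
      head≈0 = begin
        w zero                   ≈⟨ +-identityʳ _ ⟨
        w zero + 0#              ≈⟨ +-congˡ (trans (sum-cong-≋ tail≈0) (sum-replicate-zero d)) ⟨
        w zero + sum (tail w)    ≈⟨ sum≈0 ⟩
        0#                       ∎

  -- Pairing a vanishing combination with the potential dual to an edge reads off the coefficient of
  -- that edge.
  dual⇒independent : DualSystem A → (enum : Enumeration A d) →
                     LinearlyIndependent (rootₚ ∘ Enumeration.edge enum)
  dual⇒independent dual enum w comb≈0 t with dual (Enumeration.sound enum t)
  ... | φ , one , flat = begin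
    w t                                           ≈⟨ *-identityʳ _ ⟨
    w t * 1#                                      ≈⟨ *-congˡ (trans (pair-root φ (edge t)) one) ⟨
    w t * ⟨ φ , rootₚ (edge t) ⟩                  ≈⟨ sum-single (λ s → w s * ⟨ φ , rootₚ (edge s) ⟩) t off ⟨
    sum (λ s → w s * ⟨ φ , rootₚ (edge s) ⟩)      ≈⟨ pair-combination φ w (rootₚ ∘ edge) ⟨
    ⟨ φ , combination w (rootₚ ∘ edge) ⟩          ≈⟨ pair-cong φ comb≈0 ⟩
    ⟨ φ , origin ⟩                                ≈⟨ pair-origin φ ⟩
    0#                                            ∎
    where
    open Enumeration enum
    off : ∀ s → t ≢ s → w s * ⟨ φ , rootₚ (edge s) ⟩ ≈ 0#
    off s t≢s = trans
      (*-congˡ (trans (pair-root φ (edge s)) (flat (sound s) (t≢s ∘ injective))))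
      (zeroʳ _)

  -- Edges are ordered, so the edge vectors are positive roots and lie in the polytope with the
  -- origin; conversely the polytope lies in the cone, hence in their span.
  𝒫-dimension : (G : Graph m) → DualSystem (E G) → Enumeration (E G) d → HasDimension (𝒫 G) d
  𝒫-dimension G dual enum = dimension (𝒫 G) (rootₚ ∘ edge) (dual⇒independent dual enum)
    (gen∈Conv OriginOrPositiveRoot origin (inj₁ λ _ → refl) ,
     Conical⊆Cone (EdgeVector G) (nil λ _ → refl))
    (λ t → gen∈Conv OriginOrPositiveRoot (rootₚ (edge t))
             (inj₂ (_ , _ , ordered G (sound t) , λ _ → refl)) ,
           Conical⊆Cone (EdgeVector G) (gen∈Conical (_ , _ , sound t , λ _ → refl)))
    λ (_ , x∈) → spanned (Cone⊆Conical (EdgeVector G) x∈)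
    where
    open Enumeration enum
    root∈ : ∀ {e} → e ∈ E G → rootₚ e ∈ Span (rootₚ ∘ edge)
    root∈ e∈ with complete e∈
    ... | t , ≡.refl = Span-gen t

    spanned : Conical (EdgeVector G) ⊆ Span (rootₚ ∘ edge)
    spanned (nil x≋)                           = Span-resp x≋ Span-origin
    spanned (cons {α} _ (i , j , ij∈ , s≋) y∈ x≋) =
      Span-resp x≋ (Span-cons α (Span-resp s≋ (root∈ ij∈)) (spanned y∈))

  -- Intersecting the cones after the two exchanges

  DualSystem-mono : A ⊆ B → DualSystem B → DualSystem A
  DualSystem-mono A⊆B dual p∈ with dual (A⊆B p∈)
  ... | φ , one , flat = φ , one , flat ∘ A⊆B

  module _ {p q r : Pair m} (φ : Potential m) (one : drop φ p ≈ 1#) (flat : drop φ q ≈ 0#)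
           (drop-r : drop φ r ≈ drop φ p + drop φ q) (flat-B : ∀ {e} → e ∈ B → drop φ e ≈ 0#) where

    private
      drop-r≈1 : drop φ r ≈ 1#
      drop-r≈1 = trans drop-r (trans (+-cong one flat) (+-identityʳ 1#))

    -- The potential dual to p is 1 on r as well, so it sees both coefficients; on a splitting along
    -- q and r it sees only that of r.
    pair-split₁ : (s : Split p r B x) → ⟨ φ , x ⟩ ≈ Split.α s + Split.β s
    pair-split₁ s = trans (pair-split φ flat-B s)
      (+-cong (trans (*-congˡ one) (*-identityʳ _)) (trans (*-congˡ drop-r≈1) (*-identityʳ _)))

    pair-split₂ : (s : Split q r B x) → ⟨ φ , x ⟩ ≈ Split.β s
    pair-split₂ s = trans (pair-split φ flat-B s)
      (trans (+-cong (trans (*-congˡ flat) (zeroʳ _)) (trans (*-congˡ drop-r≈1) (*-identityʳ _)))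
        (+-identityˡ _))

  -- Evaluating the potentials dual to p and q on both splittings gives
  -- α s + β s ≈ β t and α t + β t ≈ β s, hence α s + α t ≈ 0.
  split-∩ : {p q r : Pair m} → DualSystem A → p ∈ A → q ∈ A → p ≢ q →
            (∀ φ → drop φ r ≈ drop φ p + drop φ q) → B ⊆ ((A ∖ ｛ p ｝) ∖ ｛ q ｝) →
            (s : Split p r B x) → Split q r B x → Split.α s ≈ 0#
  split-∩ {x = x} dual p∈ q∈ p≢q drop-r B⊆ s t with dual p∈ | dual q∈
  ... | φ , φ-one , φ-flat | ψ , ψ-one , ψ-flat =
    x+y≈0⇒x≈0 (Split.0≤α s) (Split.0≤α t) (+-cancelʳ (Split.β t) _ _ (begin
      (Split.α s + Split.α t) + Split.β t
        ≈⟨ +-assoc _ _ _ ⟩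
      Split.α s + (Split.α t + Split.β t)
        ≈⟨ +-congˡ (pair-split₁ ψ ψ-one (ψ-flat p∈ (p≢q ∘ ≡.sym)) drop-r′ ψ-B t) ⟨
      Split.α s + ⟨ ψ , x ⟩
        ≈⟨ +-congˡ (pair-split₂ ψ ψ-one (ψ-flat p∈ (p≢q ∘ ≡.sym)) drop-r′ ψ-B s) ⟩
      Split.α s + Split.β s
        ≈⟨ pair-split₁ φ φ-one (φ-flat q∈ p≢q) (drop-r φ) φ-B s ⟨
      ⟨ φ , x ⟩
        ≈⟨ pair-split₂ φ φ-one (φ-flat q∈ p≢q) (drop-r φ) φ-B t ⟩
      Split.β t
        ≈⟨ +-identityˡ _ ⟨
      0# + Split.β t ∎))
    where
    -- For ψ the roles of p and q are interchanged, and with them the two summands.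
    drop-r′ = trans (drop-r ψ) (+-comm _ _)
    φ-B = λ {e} e∈ → φ-flat {e} (proj₁ (proj₁ (B⊆ e∈))) (proj₂ (proj₁ (B⊆ e∈)))
    ψ-B = λ {e} e∈ → ψ-flat {e} (proj₁ (proj₁ (B⊆ e∈))) (proj₂ (B⊆ e∈))

  unsplit-zero : r ∈ A → B ⊆ A → (s : Split p r B x) → Split.α s ≈ 0# → x ∈ Conical (Roots A)
  unsplit-zero r∈ B⊆A s α≈0 =
    cons 0≤β (_ , _ , r∈ , λ _ → refl) (Conical-mono (Roots-mono B⊆A) y∈) λ a →
      trans (x≋ a) (trans (+-congʳ (trans (*-congʳ α≈0) (zeroˡ _))) (+-identityˡ _))
    where open Split s

-- The reduction of `G₀` to `G₁`, `G₂` and `G₃`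

lemma5 : {c ℓ₁ ℓ₂ : Level} (F : OrderedField c ℓ₁ ℓ₂) → let open RootPolytope F in
    (n d : ℕ) (G₀ G₁ G₂ G₃ : Graph (suc n)) (i j k : Fin (suc n)) →
    Acyclic G₀ → edgeCount G₀ ≡ d →
    i < j → j < k → (i , j) ∈ E G₀ → (j , k) ∈ E G₀ →
    E G₁ ≐ ((E G₀ ∖ ｛ j , k ｝) ∪ ｛ i , k ｝) →
    E G₂ ≐ ((E G₀ ∖ ｛ i , j ｝) ∪ ｛ i , k ｝) →
    E G₃ ≐ (((E G₀ ∖ ｛ i , j ｝) ∖ ｛ j , k ｝) ∪ ｛ i , k ｝) →
    (Acyclic G₁ × Acyclic G₂ × Acyclic G₃) ×
    (𝒫 G₀ ≐ (𝒫 G₁ ∪ 𝒫 G₂)) ×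
    (HasDimension (𝒫 G₀) d × HasDimension (𝒫 G₁) d × HasDimension (𝒫 G₂) d) ×
    (𝒫 G₃ ≐ (𝒫 G₁ ∩ 𝒫 G₂)) ×
    HasDimension (𝒫 G₃) (d ∸ 1)
lemma5 F n _ G₀ G₁ G₂ G₃ i j k acyclic₀ ≡.refl i<j j<k ij∈ jk∈ E₁ E₂ E₃ =
  (dual⇒acyclic dual₁ , dual⇒acyclic dual₂ , dual⇒acyclic dual₃) ,
  ((λ (x∈𝒫A , x∈) → cover x∈𝒫A (split cover₀ (conical G₀ x∈))) ,
   -- The factor `𝒫A⁺` is common to all the polytopes, so only cones are compared; here eᵢ - eₖ is
   -- expanded back along (i , j) and (j , k).
   λ { (inj₁ (x∈𝒫A , x∈)) → x∈𝒫A , cone G₀ (unsplit ij∈ jk∈ R⊆₀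
         (unmerge root-ik (split cover₁ (conical G₁ x∈))))
     ; (inj₂ (x∈𝒫A , x∈)) → x∈𝒫A , cone G₀ (unsplit jk∈ ij∈ R⊆₀
         (unmerge root-ik′ (split cover₂ (conical G₂ x∈)))) }) ,
  (𝒫-dimension G₀ dual₀ enum₀ , 𝒫-dimension G₁ dual₁ enum₁ , 𝒫-dimension G₂ dual₂ enum₂) ,
  ((λ (x∈𝒫A , x∈) →
     (x∈𝒫A , cone G₁ (Conical-mono (Roots-mono ₃⊆₁) (conical G₃ x∈))) ,
     (x∈𝒫A , cone G₂ (Conical-mono (Roots-mono ₃⊆₂) (conical G₃ x∈)))) ,
   -- Membership in both cones forces the coefficient of (i , j) in the `G₁` splitting to vanish;
   -- what remains uses (i , k) and common edges only.
   λ ((x∈𝒫A , x∈₁) , (_ , x∈₂)) →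
     let s = split cover₁ (conical G₁ x∈₁)
         t = split cover₂ (conical G₂ x∈₂)
     in x∈𝒫A , cone G₃ (unsplit-zero (proj₂ E₃ (inj₂ ≡.refl)) (proj₂ E₃ ∘′ inj₁) s
          (split-∩ dual₀ ij∈ jk∈ ij≢jk drop-ik id s t))) ,
  𝒫-dimension G₃ dual₃ enum₃
  where
  open OrderedField F
  open CommutativeRing commutativeRing using (trans; +-comm)
  open IsTotalOrder isTotalOrder using (total)
  open RootPolytope F
  open Reduction F

  R : Pred (Pair (suc n)) 0ℓ
  R = (E G₀ ∖ ｛ i , j ｝) ∖ ｛ j , k ｝

  conical : ∀ G {x} → x ∈ 𝒞 G → x ∈ Conical (Roots (E G))
  conical G = Cone⊆Conical (EdgeVector G)

  cone : ∀ G {x} → x ∈ Conical (Roots (E G)) → x ∈ 𝒞 G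
  cone G = Conical⊆Cone (EdgeVector G)

  ij≢jk : (i , j) ≢ (j , k)
  ij≢jk eq = <-irrefl (≡.cong proj₁ eq) i<j

  ij≢ik : (i , j) ≢ (i , k)
  ij≢ik eq = <-irrefl (≡.cong proj₂ eq) j<k

  drop-ik : ∀ φ → drop φ (i , k) ≈ drop φ (i , j) + drop φ (j , k)
  drop-ik φ = telescope (φ i) (φ j) (φ k)

  drop-ik′ : ∀ φ → drop φ (i , k) ≈ drop φ (j , k) + drop φ (i , j)
  drop-ik′ φ = trans (drop-ik φ) (+-comm _ _)

  root-ik : root i k ≋ (root i j ⊕ root j k)
  root-ik a = telescope (e i a) (e j a) (e k a)

  root-ik′ : root i k ≋ (root j k ⊕ root i j)
  root-ik′ a = trans (root-ik a) (+-comm _ _)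

  R⊆₀ : R ⊆ E G₀
  R⊆₀ ((e∈ , _) , _) = e∈

  R⊆₁ : R ⊆ E G₁
  R⊆₁ ((e∈ , _) , jk≢e) = proj₂ E₁ (inj₁ (e∈ , jk≢e))

  R⊆₂ : R ⊆ E G₂
  R⊆₂ (e∈ , _) = proj₂ E₂ (inj₁ e∈)

  ij∈₁ : (i , j) ∈ E G₁
  ij∈₁ = proj₂ E₁ (inj₁ (ij∈ , ij≢jk ∘ ≡.sym))

  jk∈₂ : (j , k) ∈ E G₂
  jk∈₂ = proj₂ E₂ (inj₁ (jk∈ , ij≢jk))

  ik∈₁ : (i , k) ∈ E G₁
  ik∈₁ = proj₂ E₁ (inj₂ ≡.refl)

  ik∈₂ : (i , k) ∈ E G₂
  ik∈₂ = proj₂ E₂ (inj₂ ≡.refl)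

  ₃⊆₁ : E G₃ ⊆ E G₁
  ₃⊆₁ e∈ with proj₁ E₃ e∈
  ... | inj₁ e∈R    = R⊆₁ e∈R
  ... | inj₂ ≡.refl = ik∈₁

  ₃⊆₂ : E G₃ ⊆ E G₂
  ₃⊆₂ e∈ with proj₁ E₃ e∈
  ... | inj₁ e∈R    = R⊆₂ e∈R
  ... | inj₂ ≡.refl = ik∈₂

  -- As (i , k) differs from (i , j), the third graph is the first with one edge deleted. Its
  -- enumeration thus comes from that of `G₁` by `remove`, which yields d - 1.
  E₃′ : E G₃ ≐ (E G₁ ∖ ｛ i , j ｝)
  E₃′ = (λ e∈ → ₃⊆₁ e∈ , ij≢ (proj₁ E₃ e∈)) , λ (e∈ , ij≢e) → back ij≢e (proj₁ E₁ e∈)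
    where
    ij≢ : ∀ {e} → e ∈ (R ∪ ｛ i , k ｝) → (i , j) ≢ e
    ij≢ (inj₁ ((_ , ij≢e) , _)) = ij≢e
    ij≢ (inj₂ ≡.refl)           = ij≢ik

    back : ∀ {e} → (i , j) ≢ e → e ∈ ((E G₀ ∖ ｛ j , k ｝) ∪ ｛ i , k ｝) → e ∈ E G₃
    back ij≢e (inj₁ (e∈ , jk≢e)) = proj₂ E₃ (inj₁ ((e∈ , ij≢e) , jk≢e))
    back ij≢e (inj₂ ik≡e)        = proj₂ E₃ (inj₂ ik≡e)

  dual₀ = acyclic⇒dual acyclic₀
  dual₁ = exchange dual₀ ij∈ jk∈ ij≢jk drop-ik (proj₁ E₁)
  dual₂ = exchange dual₀ jk∈ ij∈ (ij≢jk ∘ ≡.sym) drop-ik′ (proj₁ E₂)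
  dual₃ = DualSystem-mono ₃⊆₁ dual₁

  -- The added edge is really new, so `G₁` and `G₂` keep d edges.
  ik∉ : ¬ (i , k) ∈ E G₀
  ik∉ = sum-∉ dual₀ ij∈ jk∈ ij≢jk drop-ik

  enum₀ = enumerate G₀
  enum₁ = replace ik∉ jk∈ E₁ enum₀
  enum₂ = replace ik∉ ij∈ E₂ enum₀
  enum₃ = remove ij∈₁ E₃′ enum₁

  cover₀ : ∀ {e} → e ∈ E G₀ → e ≡ (i , j) ⊎ e ≡ (j , k) ⊎ e ∈ R
  cover₀ {e} e∈ with e ≟ₑ (i , j) | e ≟ₑ (j , k)
  ... | yes e≡ij | _        = inj₁ e≡ij
  ... | no _     | yes e≡jk = inj₂ (inj₁ e≡jk)
  ... | no e≢ij  | no e≢jk  = inj₂ (inj₂ ((e∈ , e≢ij ∘ ≡.sym) , e≢jk ∘ ≡.sym))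

  cover₁ : ∀ {e} → e ∈ E G₁ → e ≡ (i , j) ⊎ e ≡ (i , k) ⊎ e ∈ R
  cover₁ {e} e∈ with proj₁ E₁ e∈
  ... | inj₂ ik≡e = inj₂ (inj₁ (≡.sym ik≡e))
  ... | inj₁ (e∈₀ , jk≢e) with e ≟ₑ (i , j)
  ...   | yes e≡ij = inj₁ e≡ij
  ...   | no e≢ij  = inj₂ (inj₂ ((e∈₀ , e≢ij ∘ ≡.sym) , jk≢e))

  cover₂ : ∀ {e} → e ∈ E G₂ → e ≡ (j , k) ⊎ e ≡ (i , k) ⊎ e ∈ R
  cover₂ {e} e∈ with proj₁ E₂ e∈
  ... | inj₂ ik≡e = inj₂ (inj₁ (≡.sym ik≡e))
  ... | inj₁ (e∈₀ , ij≢e) with e ≟ₑ (j , k)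
  ...   | yes e≡jk = inj₁ e≡jk
  ...   | no e≢jk  = inj₂ (inj₂ ((e∈₀ , ij≢e) , e≢jk ∘ ≡.sym))

  -- The surplus after merging lies on (i , j), an edge of `G₁`, if β ≤ α, and on (j , k), an edge
  -- of `G₂`, if α ≤ β.
  cover : ∀ {x} → x ∈ 𝒫A⁺ → Split (i , j) (j , k) R x → x ∈ (𝒫 G₁ ∪ 𝒫 G₂)
  cover x∈𝒫A s with total (Split.β s) (Split.α s)
  ... | inj₁ β≤α = inj₁ (x∈𝒫A , cone G₁ (unsplit ij∈₁ ik∈₁ R⊆₁ (merge root-ik s β≤α)))
  ... | inj₂ α≤β = inj₂ (x∈𝒫A , cone G₂ (unsplit jk∈₂ ik∈₂ R⊆₂ (merge root-ik′ (swap s) α≤β)))
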